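{- Let $m\ge 2$ be an integer. Then the set of strongly regular graphs with smallest eigenvalue $-m$ has bounded VC-dimension; that is, there is a constant $C_m$ depending only on $m$ such that every strongly regular graph whose adjacency matrix has smallest eigenvalue $-m$ has VC-dimension at most $C_m$.
   Context: All graphs are finite and simple. A graph $G$ on $v$ vertices is strongly regular, an $\mathrm{SRG}(v,k,\lambda,\mu)$, if every vertex has degree $k$, any two adjacent vertices have exactly $\lambda$ common neighbors, and any two distinct nonadjacent vertices have exactly $\mu$ common neighbors. Eigenvalues are those of the adjacency matrix. The VC-dimension of a graph $G$ is the maximum size of a set $S\subseteq V(G)$ that is shattered, meaning that for every $A\subseteq S$ there is a vertex $u\in V(G)$ (possibly $u\in S$) with $N(u)\cap S=A$, where $N(u)$ is the open neighborhood of $u$. -}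

module Defs where

open import Algebra.Bundles using (CommutativeMonoid; RawMonoid)
open import Algebra.Definitions.RawMonoid using (sum)
import Algebra.Properties.CommutativeSemigroup as CommutativeSemigroup
open import Data.Bool using (Bool; true; false; if_then_else_)
open import Data.Fin using (Fin)
open import Data.Fin.Subset using (Subset; _⊆_; _∩_; ∣_∣)
import Data.Integer as ℤ
open import Data.Nat as ℕ using (ℕ)
import Data.Nat.Properties as ℕ
open import Data.Product using (Σ; ∃; ∃-syntax; _×_; _,_)
open import Data.Rational as ℚ using (ℚ; 0ℚ; 1ℚ)
import Data.Rational.Properties as ℚ
open import Data.Vec using (tabulate)
open import Data.Vec.Functional using (Vector)
open import Level using (0ℓ)
open import Relation.Binary.PropositionalEquality
  using (_≡_; _≢_; refl; sym; trans; cong; cong₂; subst; module ≡-Reasoning)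
open import Relation.Nullary using (¬_)

Cauchy : (ℕ → ℚ) → Set
Cauchy s = ∀ ε → 0ℚ ℚ.< ε →
  ∃[ N ] (∀ i j → N ℕ.≤ i → N ℕ.≤ j → ℚ.∣ s i ℚ.- s j ∣ ℚ.≤ ε)

record ℝ : Set where
  constructor mkℝ
  field
    seq    : ℕ → ℚ
    cauchy : Cauchy seq

open ℝ public

infix 4 _≈_ _≤ʳ_

-- Equality of reals is the relation _≈_, not propositional equality of the
-- representing sequences.
_≈_ : ℝ → ℝ → Set
x ≈ y = ∀ ε → 0ℚ ℚ.< ε →
  ∃[ N ] (∀ i → N ℕ.≤ i → ℚ.∣ seq x i ℚ.- seq y i ∣ ℚ.≤ ε)

_≤ʳ_ : ℝ → ℝ → Set
x ≤ʳ y = ∀ ε → 0ℚ ℚ.< ε →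
  ∃[ N ] (∀ i → N ℕ.≤ i → seq x i ℚ.≤ seq y i ℚ.+ ε)

fromℚ : ℚ → ℝ
fromℚ q = mkℝ (λ _ → q) λ ε 0<ε → 0 , λ _ _ _ _ →
  subst (ℚ._≤ ε) (sym (cong ℚ.∣_∣ (ℚ.+-inverseʳ q))) (ℚ.<⇒≤ 0<ε)

fromℤ : ℤ.ℤ → ℝ
fromℤ z = fromℚ (z ℚ./ 1)

0ʳ 1ʳ : ℝ
0ʳ = fromℚ 0ℚ
1ʳ = fromℚ 1ℚ

private
  quotient : ∀ ε B → 0ℚ ℚ.< ε → 0ℚ ℚ.< B →
             ∃[ δ ] (0ℚ ℚ.< δ × δ ℚ.* B ≡ ε)
  quotient ε B 0<ε 0<B = ε ℚ.* ℚ.1/ B , 0<δ , eq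
    where
    instance
      posε : ℚ.Positive ε
      posε = ℚ.positive 0<ε
      posB : ℚ.Positive B
      posB = ℚ.positive 0<B
      nzB : ℚ.NonZero B
      nzB = ℚ.pos⇒nonZero B
      pos1/B : ℚ.Positive (ℚ.1/ B)
      pos1/B = ℚ.1/pos⇒pos B
    0<δ : 0ℚ ℚ.< ε ℚ.* ℚ.1/ B
    0<δ = ℚ.positive⁻¹ (ε ℚ.* ℚ.1/ B) {{ℚ.pos*pos⇒pos ε (ℚ.1/ B)}}
    eq : ε ℚ.* ℚ.1/ B ℚ.* B ≡ ε
    eq = trans (ℚ.*-assoc ε (ℚ.1/ B) B)
           (trans (cong (ε ℚ.*_) (ℚ.*-inverseˡ B)) (ℚ.*-identityʳ ε))

  split : ∀ a b → a ≡ (a ℚ.- b) ℚ.+ b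
  split a b = sym (trans (ℚ.+-assoc a (ℚ.- b) b)
    (trans (cong (a ℚ.+_) (ℚ.+-inverseˡ b)) (ℚ.+-identityʳ a)))

  0<1 : 0ℚ ℚ.< 1ℚ
  0<1 = ℚ.positive⁻¹ 1ℚ

  eventuallyBounded : ∀ s → Cauchy s →
    ∃[ B ] (0ℚ ℚ.< B × ∃[ N ] (∀ i → N ℕ.≤ i → ℚ.∣ s i ∣ ℚ.≤ B))
  eventuallyBounded s c with c 1ℚ 0<1
  ... | N , h = 1ℚ ℚ.+ ℚ.∣ s N ∣ , ℚ.+-mono-<-≤ 0<1 (ℚ.0≤∣p∣ (s N)) , N , bound
    where
    bound : ∀ i → N ℕ.≤ i → ℚ.∣ s i ∣ ℚ.≤ 1ℚ ℚ.+ ℚ.∣ s N ∣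
    bound i N≤i = begin
      ℚ.∣ s i ∣                          ≡⟨ cong ℚ.∣_∣ (split (s i) (s N)) ⟩
      ℚ.∣ (s i ℚ.- s N) ℚ.+ s N ∣        ≤⟨ ℚ.∣p+q∣≤∣p∣+∣q∣ (s i ℚ.- s N) (s N) ⟩
      ℚ.∣ s i ℚ.- s N ∣ ℚ.+ ℚ.∣ s N ∣    ≤⟨ ℚ.+-monoˡ-≤ ℚ.∣ s N ∣ (h i N N≤i ℕ.≤-refl) ⟩
      1ℚ ℚ.+ ℚ.∣ s N ∣                   ∎
      where open ℚ.≤-Reasoning

  *-mono : ∀ {a b c d} → 0ℚ ℚ.≤ a → 0ℚ ℚ.≤ d → a ℚ.≤ b → c ℚ.≤ d →
           a ℚ.* c ℚ.≤ b ℚ.* d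
  *-mono {a} {b} {c} {d} 0≤a 0≤d a≤b c≤d = ℚ.≤-trans
    (ℚ.*-monoˡ-≤-nonNeg a {{ℚ.nonNegative 0≤a}} c≤d)
    (ℚ.*-monoʳ-≤-nonNeg d {{ℚ.nonNegative 0≤d}} a≤b)

  +-cauchy : ∀ s t → Cauchy s → Cauchy t → Cauchy (λ i → s i ℚ.+ t i)
  +-cauchy s t cs ct ε 0<ε with quotient ε (1ℚ ℚ.+ 1ℚ) 0<ε (ℚ.positive⁻¹ (1ℚ ℚ.+ 1ℚ))
  ... | δ , 0<δ , δ*2≡ε with cs δ 0<δ | ct δ 0<δ
  ... | M , hs | N , ht = M ℕ.⊔ N , close
    where
    rearrange : ∀ a b c d → (a ℚ.+ b) ℚ.- (c ℚ.+ d) ≡ (a ℚ.- c) ℚ.+ (b ℚ.- d)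
    rearrange a b c d = trans
      (cong ((a ℚ.+ b) ℚ.+_) (ℚ.neg-distrib-+ c d))
      (interchange a b (ℚ.- c) (ℚ.- d))
      where
      open CommutativeSemigroup
        (CommutativeMonoid.commutativeSemigroup ℚ.+-0-commutativeMonoid) using (interchange)
    double : δ ℚ.+ δ ≡ ε
    double = trans
      (sym (trans (ℚ.*-distribˡ-+ δ 1ℚ 1ℚ)
                  (cong₂ ℚ._+_ (ℚ.*-identityʳ δ) (ℚ.*-identityʳ δ)))) δ*2≡ε
    close : ∀ i j → M ℕ.⊔ N ℕ.≤ i → M ℕ.⊔ N ℕ.≤ j →
            ℚ.∣ (s i ℚ.+ t i) ℚ.- (s j ℚ.+ t j) ∣ ℚ.≤ ε
    close i j p q = begin
      ℚ.∣ (s i ℚ.+ t i) ℚ.- (s j ℚ.+ t j) ∣      ≡⟨ cong ℚ.∣_∣ (rearrange (s i) (t i) (s j) (t j)) ⟩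
      ℚ.∣ (s i ℚ.- s j) ℚ.+ (t i ℚ.- t j) ∣      ≤⟨ ℚ.∣p+q∣≤∣p∣+∣q∣ (s i ℚ.- s j) (t i ℚ.- t j) ⟩
      ℚ.∣ s i ℚ.- s j ∣ ℚ.+ ℚ.∣ t i ℚ.- t j ∣    ≤⟨ ℚ.+-mono-≤
                                                      (hs i j (ℕ.m⊔n≤o⇒m≤o M N p) (ℕ.m⊔n≤o⇒m≤o M N q))
                                                      (ht i j (ℕ.m⊔n≤o⇒n≤o M N p) (ℕ.m⊔n≤o⇒n≤o M N q)) ⟩
      δ ℚ.+ δ                                    ≡⟨ double ⟩
      ε                                          ∎
      where open ℚ.≤-Reasoning

  *-cauchy : ∀ s t → Cauchy s → Cauchy t → Cauchy (λ i → s i ℚ.* t i)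
  *-cauchy s t cs ct ε 0<ε
    with eventuallyBounded s cs | eventuallyBounded t ct
  ... | B , 0<B , K , bs | C , 0<C , L , bt
    with quotient ε (B ℚ.+ C) 0<ε (ℚ.+-mono-< 0<B 0<C)
  ... | δ , 0<δ , δ*[B+C]≡ε with cs δ 0<δ | ct δ 0<δ
  ... | M , hs | N , ht = (K ℕ.⊔ L) ℕ.⊔ (M ℕ.⊔ N) , close
    where
    rearrange : ∀ a b c d →
      a ℚ.* b ℚ.- c ℚ.* d ≡ a ℚ.* (b ℚ.- d) ℚ.+ (a ℚ.- c) ℚ.* d
    rearrange a b c d = sym (begin
      a ℚ.* (b ℚ.- d) ℚ.+ (a ℚ.- c) ℚ.* d
        ≡⟨ cong₂ ℚ._+_ (ℚ.*-distribˡ-+ a b (ℚ.- d)) (ℚ.*-distribʳ-+ d a (ℚ.- c)) ⟩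
      (a ℚ.* b ℚ.+ a ℚ.* ℚ.- d) ℚ.+ (a ℚ.* d ℚ.+ ℚ.- c ℚ.* d)
        ≡⟨ cong₂ (λ x y → (a ℚ.* b ℚ.+ x) ℚ.+ (a ℚ.* d ℚ.+ y))
                 (sym (ℚ.neg-distribʳ-* a d)) (sym (ℚ.neg-distribˡ-* c d)) ⟩
      (a ℚ.* b ℚ.- a ℚ.* d) ℚ.+ (a ℚ.* d ℚ.- c ℚ.* d)
        ≡⟨ sym (ℚ.+-assoc (a ℚ.* b ℚ.- a ℚ.* d) (a ℚ.* d) (ℚ.- (c ℚ.* d))) ⟩
      ((a ℚ.* b ℚ.- a ℚ.* d) ℚ.+ a ℚ.* d) ℚ.- c ℚ.* d
        ≡⟨ cong (ℚ._- c ℚ.* d) (sym (split (a ℚ.* b) (a ℚ.* d))) ⟩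
      a ℚ.* b ℚ.- c ℚ.* d ∎)
      where open ≡-Reasoning
    total : B ℚ.* δ ℚ.+ δ ℚ.* C ≡ ε
    total = trans (cong (ℚ._+ δ ℚ.* C) (ℚ.*-comm B δ))
              (trans (sym (ℚ.*-distribˡ-+ δ B C)) δ*[B+C]≡ε)
    close : ∀ i j → (K ℕ.⊔ L) ℕ.⊔ (M ℕ.⊔ N) ℕ.≤ i → (K ℕ.⊔ L) ℕ.⊔ (M ℕ.⊔ N) ℕ.≤ j →
            ℚ.∣ s i ℚ.* t i ℚ.- s j ℚ.* t j ∣ ℚ.≤ ε
    close i j p q = begin
      ℚ.∣ s i ℚ.* t i ℚ.- s j ℚ.* t j ∣
        ≡⟨ cong ℚ.∣_∣ (rearrange (s i) (t i) (s j) (t j)) ⟩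
      ℚ.∣ s i ℚ.* (t i ℚ.- t j) ℚ.+ (s i ℚ.- s j) ℚ.* t j ∣
        ≤⟨ ℚ.∣p+q∣≤∣p∣+∣q∣ (s i ℚ.* (t i ℚ.- t j)) ((s i ℚ.- s j) ℚ.* t j) ⟩
      ℚ.∣ s i ℚ.* (t i ℚ.- t j) ∣ ℚ.+ ℚ.∣ (s i ℚ.- s j) ℚ.* t j ∣
        ≡⟨ cong₂ ℚ._+_ (ℚ.∣p*q∣≡∣p∣*∣q∣ (s i) (t i ℚ.- t j))
                       (ℚ.∣p*q∣≡∣p∣*∣q∣ (s i ℚ.- s j) (t j)) ⟩
      ℚ.∣ s i ∣ ℚ.* ℚ.∣ t i ℚ.- t j ∣ ℚ.+ ℚ.∣ s i ℚ.- s j ∣ ℚ.* ℚ.∣ t j ∣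
        ≤⟨ ℚ.+-mono-≤
             (*-mono (ℚ.0≤∣p∣ (s i)) (ℚ.<⇒≤ 0<δ) (bs i K≤i) (ht i j N≤i N≤j))
             (*-mono (ℚ.0≤∣p∣ (s i ℚ.- s j)) (ℚ.<⇒≤ 0<C) (hs i j M≤i M≤j) (bt j L≤j)) ⟩
      B ℚ.* δ ℚ.+ δ ℚ.* C
        ≡⟨ total ⟩
      ε ∎
      where
      open ℚ.≤-Reasoning
      K≤i = ℕ.m⊔n≤o⇒m≤o K L (ℕ.m⊔n≤o⇒m≤o (K ℕ.⊔ L) (M ℕ.⊔ N) p)
      L≤j = ℕ.m⊔n≤o⇒n≤o K L (ℕ.m⊔n≤o⇒m≤o (K ℕ.⊔ L) (M ℕ.⊔ N) q)
      M≤i = ℕ.m⊔n≤o⇒m≤o M N (ℕ.m⊔n≤o⇒n≤o (K ℕ.⊔ L) (M ℕ.⊔ N) p)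
      M≤j = ℕ.m⊔n≤o⇒m≤o M N (ℕ.m⊔n≤o⇒n≤o (K ℕ.⊔ L) (M ℕ.⊔ N) q)
      N≤i = ℕ.m⊔n≤o⇒n≤o M N (ℕ.m⊔n≤o⇒n≤o (K ℕ.⊔ L) (M ℕ.⊔ N) p)
      N≤j = ℕ.m⊔n≤o⇒n≤o M N (ℕ.m⊔n≤o⇒n≤o (K ℕ.⊔ L) (M ℕ.⊔ N) q)

infixl 6 _+ʳ_
infixl 7 _*ʳ_

_+ʳ_ : ℝ → ℝ → ℝ
x +ʳ y = mkℝ (λ i → seq x i ℚ.+ seq y i) (+-cauchy (seq x) (seq y) (cauchy x) (cauchy y))

_*ʳ_ : ℝ → ℝ → ℝ
x *ʳ y = mkℝ (λ i → seq x i ℚ.* seq y i) (*-cauchy (seq x) (seq y) (cauchy x) (cauchy y))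

+ʳ-rawMonoid : RawMonoid 0ℓ 0ℓ
+ʳ-rawMonoid = record { Carrier = ℝ ; _≈_ = _≈_ ; _∙_ = _+ʳ_ ; ε = 0ʳ }

Matrix : ℕ → Set
Matrix n = Fin n → Fin n → ℝ

_·_ : ∀ {n} → Matrix n → Vector ℝ n → Vector ℝ n
(M · x) i = sum +ʳ-rawMonoid (λ j → M i j *ʳ x j)

-- Only real eigenvalues are considered; for a real symmetric matrix these are
-- all of the eigenvalues.
IsEigenvalue : ∀ {n} → Matrix n → ℝ → Set
IsEigenvalue {n} M θ = Σ (Vector ℝ n) λ x →
  ¬ (∀ i → x i ≈ 0ʳ) × (∀ i → (M · x) i ≈ θ *ʳ x i)

IsSmallestEigenvalue : ∀ {n} → Matrix n → ℝ → Set
IsSmallestEigenvalue M θ = IsEigenvalue M θ × (∀ η → IsEigenvalue M η → θ ≤ʳ η)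

record Graph (n : ℕ) : Set where
  field
    adj       : Fin n → Fin n → Bool
    symmetric : ∀ u w → adj u w ≡ adj w u
    loopless  : ∀ u → adj u u ≡ false

open Graph public

module _ {n : ℕ} (G : Graph n) where

  N : Fin n → Subset n
  N u = tabulate (adj G u)

  adjacencyMatrix : Matrix n
  adjacencyMatrix u w = if adj G u w then 1ʳ else 0ʳ

  Shattered : Subset n → Set
  Shattered S = ∀ A → A ⊆ S → ∃[ u ] N u ∩ S ≡ A

  -- The graph on no vertices has no VC-dimension in this sense, since then not
  -- even the empty set is shattered.
  IsVCDimension : ℕ → Set
  IsVCDimension d =
    (∃[ S ] (Shattered S × ∣ S ∣ ≡ d)) × (∀ S → Shattered S → ∣ S ∣ ℕ.≤ d)

record IsSRG {v : ℕ} (G : Graph v) (k lam mu : ℕ) : Set where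
  field
    regular     : ∀ u → ∣ N G u ∣ ≡ k
    adjacent    : ∀ u w → adj G u w ≡ true → ∣ N G u ∩ N G w ∣ ≡ lam
    nonadjacent : ∀ u w → u ≢ w → adj G u w ≡ false → ∣ N G u ∩ N G w ∣ ≡ mu

StronglyRegular : ∀ {v} → Graph v → Set
StronglyRegular G = ∃[ k ] ∃[ lam ] ∃[ mu ] IsSRG G k lam mu

{-# OPTIONS --safe #-}
-- Let S be shattered and A the adjacency matrix. A greedy choice of signs gives
-- a ±1 vector x supported on S with xᵀAx ≤ 0. Some vertex u is adjacent to
-- exactly the negative part P of S, so y = x + αe_u has yᵀAy ≤ −2α|P|; together
-- with the same bound for −x, positivity of A + mI yields
-- α|S| ≤ m (|S| + 2α + α²), and α = m + 1 bounds |S| by m(m+1)(m+3).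
--
-- Positivity of A + mI needs no spectral theorem here: an eigenvector for −m has
-- entry sum 0, so −m is a root of t² − (λ − μ)t − (k − μ), and with c the other
-- root (A + mI)² = (c + m)(A + mI) + μJ. As c ≥ 0, it remains to absorb the
-- term μJ, which is the Cauchy–Schwarz inequality against the all-ones vector.
module Submission where

open import Defs
open import Data.Nat using (ℕ; _≤_)
open import Data.Product using (∃-syntax; _×_)

open import Algebra.Bundles using (CommutativeRing; Semiring)
import Algebra.Definitions.RawMonoid as RawMonoid
import Algebra.Properties.Semiring.Mult as Mult
import Algebra.Properties.Semiring.Sum as Sum
open import Data.Bool using (Bool; true; false; if_then_else_; _∧_; not)
import Data.Bool.Properties as Bool
open import Data.Fin as Fin using (Fin; zero; suc)
import Data.Fin.Properties as Fin
open import Data.Fin.Subset using (Subset; _⊆_; _∩_; ∣_∣; ⊥)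
import Data.Fin.Subset.Properties as Subset
import Data.Integer as ℤ
import Data.Integer.Properties as ℤ
open import Data.Nat as ℕ using (zero; suc)
import Data.Nat.Properties as ℕ
open import Data.Product using (_,_; proj₁; proj₂)
open import Data.Rational as ℚ using (ℚ; 0ℚ; 1ℚ; _+_; _*_; _-_)
import Data.Rational.Properties as ℚ
open import Data.Rational.Solver using (module +-*-Solver)
import Data.Rational.Unnormalised as ℚᵘ
import Data.Rational.Unnormalised.Properties as ℚᵘ
open import Data.Sum using (inj₁; inj₂)
open import Data.Vec as Vec using (lookup; tabulate)
open import Data.Vec.Functional as Vector using (Vector)
import Data.Vec.Properties as Vec
open import Function using (_∘_)
open import Level using (0ℓ)
open import Relation.Binary.PropositionalEquality
  using (_≡_; _≢_; refl; sym; trans; cong; cong₂; subst; subst₂; module ≡-Reasoning)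
open import Relation.Nullary using (Dec; yes; no; does; contradiction)
open import Relation.Nullary.Decidable
  using (dec-true; dec-false; decidable-stable; map′; ¬?; _×-dec_)
open import Relation.Unary using (Decidable)

open +-*-Solver using (solve; con; _:+_; _:*_; _:-_; :-_; _:=_)

ℚ-semiring : Semiring 0ℓ 0ℓ
ℚ-semiring = CommutativeRing.semiring ℚ.+-*-commutativeRing

open Sum ℚ-semiring
  using (sum; sum-syntax; sum-cong-≗; ∑-distrib-+; ∑-comm; *-distribˡ-sum; sum-replicate; sum-replicate-zero)
open Mult ℚ-semiring using (×1-homo-*) renaming (_×_ to _×ℚ_)

private
  variable
    n : ℕ

-- Counting in the rationals: naturals as sums of ones, indicators and cardinalities.

ι : ℕ → ℚ
ι n = n ×ℚ 1ℚ

0≤ι : ∀ n → 0ℚ ℚ.≤ ι n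
0≤ι zero    = ℚ.≤-refl
0≤ι (suc n) = ℚ.+-mono-≤ (ℚ.<⇒≤ (ℚ.positive⁻¹ 1ℚ)) (0≤ι n)

ι-mono-≤ : ∀ {a b} → a ℕ.≤ b → ι a ℚ.≤ ι b
ι-mono-≤ {b = b} ℕ.z≤n = 0≤ι b
ι-mono-≤ (ℕ.s≤s a≤b)   = ℚ.+-monoʳ-≤ 1ℚ (ι-mono-≤ a≤b)

ι-mono-< : ∀ {a b} → a ℕ.< b → ι a ℚ.< ι b
ι-mono-< {a} a<b = ℚ.<-≤-trans
  (subst (ℚ._< ι (suc a)) (ℚ.+-identityˡ (ι a)) (ℚ.+-monoˡ-< (ι a) (ℚ.positive⁻¹ 1ℚ)))
  (ι-mono-≤ a<b)

ι-cancel-≤ : ∀ {a b} → ι a ℚ.≤ ι b → a ℕ.≤ b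
ι-cancel-≤ {a} {b} ιa≤ιb with a ℕ.≤? b
... | yes a≤b = a≤b
... | no  a≰b = contradiction (ℚ.<-≤-trans (ι-mono-< (ℕ.≰⇒> a≰b)) ιa≤ιb) (ℚ.<-irrefl refl)

ind : Bool → ℚ
ind b = if b then 1ℚ else 0ℚ

ind-∧ : ∀ p q → ind (p ∧ q) ≡ ind p * ind q
ind-∧ false q = sym (ℚ.*-zeroˡ (ind q))
ind-∧ true  q = sym (ℚ.*-identityˡ (ind q))

∑-ind : ∀ (f : Fin n → Bool) → sum (ind ∘ f) ≡ ι ∣ tabulate f ∣
∑-ind {zero}  f = refl
∑-ind {suc n} f with f zero
... | true  = cong (1ℚ +_) (∑-ind (f ∘ suc))
... | false = trans (ℚ.+-identityˡ _) (∑-ind (f ∘ suc))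

tabulate-∩ : ∀ (f g : Fin n → Bool) → tabulate f ∩ tabulate g ≡ tabulate (λ i → f i ∧ g i)
tabulate-∩ {zero}  f g = refl
tabulate-∩ {suc n} f g = cong (f zero ∧ g zero Vec.∷_) (tabulate-∩ (f ∘ suc) (g ∘ suc))

-- Inner products and matrix action on rational vectors.

infix 8 _∙_ _⊛_

_∙_ : Vector ℚ n → Vector ℚ n → ℚ
x ∙ y = ∑[ i < _ ] (x i * y i)

_⊛_ : (Fin n → Fin n → ℚ) → Vector ℚ n → Vector ℚ n
(a ⊛ x) i = a i ∙ x

∙-congˡ : ∀ {x x′ : Vector ℚ n} y → (∀ i → x i ≡ x′ i) → x ∙ y ≡ x′ ∙ y
∙-congˡ y eq = sum-cong-≗ (λ i → cong (_* y i) (eq i))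

∙-congʳ : ∀ (x : Vector ℚ n) {y y′} → (∀ i → y i ≡ y′ i) → x ∙ y ≡ x ∙ y′
∙-congʳ x eq = sum-cong-≗ (λ i → cong (x i *_) (eq i))

∙-comm : ∀ (x y : Vector ℚ n) → x ∙ y ≡ y ∙ x
∙-comm x y = sum-cong-≗ (λ i → ℚ.*-comm (x i) (y i))

∙-distribˡ-+ : ∀ (x y z : Vector ℚ n) → x ∙ (λ i → y i + z i) ≡ x ∙ y + x ∙ z
∙-distribˡ-+ x y z = trans
  (sum-cong-≗ (λ i → ℚ.*-distribˡ-+ (x i) (y i) (z i)))
  (∑-distrib-+ (λ i → x i * y i) (λ i → x i * z i))

∙-distribʳ-+ : ∀ (x y z : Vector ℚ n) → (λ i → y i + z i) ∙ x ≡ y ∙ x + z ∙ x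
∙-distribʳ-+ x y z = trans (∙-comm (λ i → y i + z i) x)
  (trans (∙-distribˡ-+ x y z) (cong₂ _+_ (∙-comm x y) (∙-comm x z)))

∙-scaleʳ : ∀ c (x y : Vector ℚ n) → x ∙ (λ i → c * y i) ≡ c * x ∙ y
∙-scaleʳ c x y = trans
  (sum-cong-≗ (λ i → solve 3 (λ c p q → p :* (c :* q) := c :* (p :* q)) refl c (x i) (y i)))
  (sym (*-distribˡ-sum c (λ i → x i * y i)))

∙-scaleˡ : ∀ c (x y : Vector ℚ n) → (λ i → c * x i) ∙ y ≡ c * x ∙ y
∙-scaleˡ c x y = trans (∙-comm (λ i → c * x i) y) (trans (∙-scaleʳ c y x) (cong (c *_) (∙-comm y x)))

-- Both sides are the same double sum with the order of summation exchanged. Taken with a row of a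
-- matrix for `x`, it reads off the entries of a matrix product.
∙-assoc : ∀ (x : Vector ℚ n) a y → x ∙ (a ⊛ y) ≡ (λ j → ∑[ i < n ] (x i * a i j)) ∙ y
∙-assoc {n} x a y = begin
  x ∙ (a ⊛ y)
    ≡⟨ sum-cong-≗ (λ i → *-distribˡ-sum (x i) (λ j → a i j * y j)) ⟩
  ∑[ i < n ] ∑[ j < n ] (x i * (a i j * y j))
    ≡⟨ ∑-comm (λ i j → x i * (a i j * y j)) ⟩
  ∑[ j < n ] ∑[ i < n ] (x i * (a i j * y j))
    ≡⟨ sum-cong-≗ (λ j → trans
         (sum-cong-≗ (λ i → solve 3 (λ p q r → p :* (q :* r) := r :* (p :* q)) refl (x i) (a i j) (y j)))
         (trans (sym (*-distribˡ-sum (y j) (λ i → x i * a i j))) (ℚ.*-comm (y j) _))) ⟩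
  (λ j → ∑[ i < n ] (x i * a i j)) ∙ y ∎
  where open ≡-Reasoning

selfAdjoint : ∀ {a : Fin n → Fin n → ℚ} → (∀ i j → a i j ≡ a j i) →
              ∀ x y → x ∙ (a ⊛ y) ≡ (a ⊛ x) ∙ y
selfAdjoint {a = a} a-sym x y = trans (∙-assoc x a y)
  (∙-congˡ y (λ j → sum-cong-≗ (λ i → trans (ℚ.*-comm (x i) (a i j)) (cong (_* x i) (a-sym i j)))))

𝟙 : Vector ℚ n
𝟙 _ = 1ℚ

∙-𝟙 : ∀ (x : Vector ℚ n) → x ∙ 𝟙 ≡ sum x
∙-𝟙 x = sum-cong-≗ (λ i → ℚ.*-identityʳ (x i))

sum-𝟙 : sum (𝟙 {n}) ≡ ι n
sum-𝟙 {n} = sum-replicate n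

-- With both arguments free this is the identity matrix, so `form-+-unit` computes norms as well as
-- values of the adjacency form.
unit : Fin n → Vector ℚ n
unit u i = ind (does (u Fin.≟ i))

unit-∙ : ∀ (u : Fin n) x → unit u ∙ x ≡ x u
unit-∙ {suc n} zero    x = trans
  (cong₂ _+_ (ℚ.*-identityˡ (x zero))
    (trans (sum-cong-≗ (λ i → ℚ.*-zeroˡ (x (suc i)))) (sum-replicate-zero n)))
  (ℚ.+-identityʳ (x zero))
unit-∙ {suc n} (suc u) x = trans
  (cong₂ _+_ (ℚ.*-zeroˡ (x zero)) (unit-∙ u (x ∘ suc)))
  (ℚ.+-identityˡ (x (suc u)))

-- Order facts and the Cauchy-Schwarz inequality.

0≤p*p : ∀ p → 0ℚ ℚ.≤ p * p
0≤p*p p with ℚ.≤-total 0ℚ p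
... | inj₁ 0≤p = subst (ℚ._≤ p * p) (ℚ.*-zeroʳ p) (ℚ.*-monoˡ-≤-nonNeg p {{ℚ.nonNegative 0≤p}} 0≤p)
... | inj₂ p≤0 = subst (ℚ._≤ p * p) (ℚ.*-zeroʳ p) (ℚ.*-monoˡ-≤-nonPos p {{ℚ.nonPositive p≤0}} p≤0)

0≤p*q : ∀ {p q} → 0ℚ ℚ.≤ p → 0ℚ ℚ.≤ q → 0ℚ ℚ.≤ p * q
0≤p*q {p} {q} 0≤p 0≤q = subst (ℚ._≤ p * q) (ℚ.*-zeroʳ p) (ℚ.*-monoˡ-≤-nonNeg p {{ℚ.nonNegative 0≤p}} 0≤q)

0≤sum : ∀ (x : Vector ℚ n) → (∀ i → 0ℚ ℚ.≤ x i) → 0ℚ ℚ.≤ sum x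
0≤sum {zero}  x 0≤x = ℚ.≤-refl
0≤sum {suc n} x 0≤x = ℚ.+-mono-≤ (0≤x zero) (0≤sum (x ∘ suc) (0≤x ∘ suc))

0≤q-p⇒p≤q : ∀ {p q} → 0ℚ ℚ.≤ q - p → p ℚ.≤ q
0≤q-p⇒p≤q {p} {q} 0≤q-p = subst₂ ℚ._≤_ (ℚ.+-identityˡ p)
  (solve 2 (λ p q → (q :- p) :+ p := q) refl p q) (ℚ.+-monoˡ-≤ p 0≤q-p)

-- Scaling `x` by its length n and subtracting its sum s from every entry gives a vector `z`
-- orthogonal to the all-ones vector. Its squared norm is n (n x·x - s²), and the positive factor n
-- cancels.
cauchySchwarz-sum : ∀ (x : Vector ℚ n) → sum x * sum x ℚ.≤ ι n * x ∙ x
cauchySchwarz-sum {zero}  x = ℚ.≤-refl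
cauchySchwarz-sum {suc n} x = 0≤q-p⇒p≤q (ℚ.*-cancelˡ-≤-pos (ι (suc n)) {{pos}} (begin
  ι (suc n) * 0ℚ ≡⟨ ℚ.*-zeroʳ (ι (suc n)) ⟩
  0ℚ             ≤⟨ 0≤sum (λ i → z i * z i) (λ i → 0≤p*p (z i)) ⟩
  z ∙ z          ≡⟨ z∙z ⟩
  ι (suc n) * (ι (suc n) * x ∙ x - s * s) ∎))
  where
  open ℚ.≤-Reasoning
  pos : ℚ.Positive (ι (suc n))
  pos = ℚ.positive (ι-mono-< {0} {suc n} (ℕ.s≤s ℕ.z≤n))
  s : ℚ
  s = sum x
  z : Vector ℚ (suc n)
  z i = ι (suc n) * x i + (ℚ.- s) * 𝟙 i
  z-∙ : ∀ y → y ∙ z ≡ ι (suc n) * y ∙ x + (ℚ.- s) * sum y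
  z-∙ y = trans (∙-distribˡ-+ y (λ i → ι (suc n) * x i) (λ i → (ℚ.- s) * 𝟙 i))
    (cong₂ _+_ (∙-scaleʳ (ι (suc n)) y x)
      (trans (∙-scaleʳ (ℚ.- s) y 𝟙) (cong ((ℚ.- s) *_) (∙-𝟙 y))))
  sum-z : sum z ≡ 0ℚ
  sum-z = trans (sym (∙-𝟙 z)) (trans (∙-comm z 𝟙) (trans (z-∙ 𝟙)
    (trans (cong₂ (λ p q → ι (suc n) * p + (ℚ.- s) * q) (trans (∙-comm 𝟙 x) (∙-𝟙 x)) (sum-𝟙 {suc n}))
      (solve 2 (λ N s → N :* s :+ (:- s) :* N := con 0ℚ) refl (ι (suc n)) s))))
  z∙z : z ∙ z ≡ ι (suc n) * (ι (suc n) * x ∙ x - s * s)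
  z∙z = trans (z-∙ z) (trans
    (cong₂ (λ p q → ι (suc n) * p + (ℚ.- s) * q) (trans (∙-comm z x) (z-∙ x)) sum-z)
    (solve 3 (λ N s X → N :* (N :* X :+ (:- s) :* s) :+ (:- s) :* con 0ℚ := N :* (N :* X :- s :* s))
      refl (ι (suc n)) s (x ∙ x)))

unit-sym : ∀ (i j : Fin n) → unit i j ≡ unit j i
unit-sym i j with i Fin.≟ j
... | yes refl rewrite dec-true (i Fin.≟ i) refl = refl
... | no i≢j   rewrite dec-false (j Fin.≟ i) (i≢j ∘ sym) = refl

form-+-unit : ∀ (a : Fin n → Fin n → ℚ) → (∀ i j → a i j ≡ a j i) → ∀ x α u →
  let y = λ i → x i + α * unit u i in
  y ∙ (a ⊛ y) ≡ x ∙ (a ⊛ x) + (α + α) * (a ⊛ x) u + α * α * a u u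
form-+-unit a a-sym x α u = begin
  y ∙ (a ⊛ y)
    ≡⟨ ∙-distribʳ-+ (a ⊛ y) x f ⟩
  x ∙ (a ⊛ y) + f ∙ (a ⊛ y)
    ≡⟨ cong₂ _+_ (trans (selfAdjoint a-sym x y) (∙-distribˡ-+ (a ⊛ x) x f))
                 (trans (f-∙ (a ⊛ y)) (cong (α *_) (trans (∙-distribˡ-+ (a u) x f)
                   (cong ((a ⊛ x) u +_) (trans (∙-comm (a u) f) (f-∙ (a u))))))) ⟩
  ((a ⊛ x) ∙ x + (a ⊛ x) ∙ f) + α * ((a ⊛ x) u + α * a u u)
    ≡⟨ cong₂ (λ p q → (p + q) + α * ((a ⊛ x) u + α * a u u))
         (∙-comm (a ⊛ x) x) (trans (∙-comm (a ⊛ x) f) (f-∙ (a ⊛ x))) ⟩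
  (x ∙ (a ⊛ x) + α * (a ⊛ x) u) + α * ((a ⊛ x) u + α * a u u)
    ≡⟨ solve 4 (λ q α t d → (q :+ α :* t) :+ α :* (t :+ α :* d) := q :+ (α :+ α) :* t :+ α :* α :* d)
         refl (x ∙ (a ⊛ x)) α ((a ⊛ x) u) (a u u) ⟩
  x ∙ (a ⊛ x) + (α + α) * (a ⊛ x) u + α * α * a u u ∎
  where
  open ≡-Reasoning
  f y : Vector ℚ _
  f i = α * unit u i
  y i = x i + f i
  f-∙ : ∀ z → f ∙ z ≡ α * z u
  f-∙ z = trans (∙-scaleˡ α (unit u) z) (cong (α *_) (unit-∙ u z))

-- Strongly regular graphs

weights : Graph n → Fin n → Fin n → ℚ
weights G u w = ind (adj G u w)

weights-sym : ∀ (G : Graph n) u w → weights G u w ≡ weights G w u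
weights-sym G u w = cong ind (symmetric G u w)

-- A complete graph is an SRG with any μ, so μ can be normalised to 0 there.
μ≤k-parameters : ∀ (G : Graph n) → StronglyRegular G →
                 ∃[ k ] ∃[ lam ] ∃[ mu ] (IsSRG G k lam mu × mu ℕ.≤ k)
μ≤k-parameters G (k , lam , mu , srg)
  with Fin.any? (λ u → Fin.any? (λ w → ¬? (u Fin.≟ w) ×-dec (adj G u w Bool.≟ false)))
... | yes (u , w , u≢w , uw) = k , lam , mu , srg , (begin
    mu               ≡⟨ sym (nonadjacent u w u≢w uw) ⟩
    ∣ N G u ∩ N G w ∣ ≤⟨ Subset.∣p∩q∣≤∣p∣ (N G u) (N G w) ⟩
    ∣ N G u ∣         ≡⟨ regular u ⟩
    k                ∎)
  where
  open IsSRG srg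
  open ℕ.≤-Reasoning
... | no complete = k , lam , 0 , srg₀ , ℕ.z≤n
  where
  open IsSRG srg
  srg₀ : IsSRG G k lam 0
  srg₀ = record
    { regular     = regular
    ; adjacent    = adjacent
    ; nonadjacent = λ u w u≢w uw → contradiction (u , w , u≢w , uw) complete
    }

module SRG {v} (G : Graph v) {k lam mu} (srg : IsSRG G k lam mu) (m : ℚ) where

  open IsSRG srg

  private
    a : Fin v → Fin v → ℚ
    a = weights G

  row-sum : ∀ u → sum (a u) ≡ ι k
  row-sum u = trans (∑-ind (adj G u)) (cong ι (regular u))

  -- An entry of A² counts walks of length two; by symmetry of A the midpoint of such a walk is a
  -- common neighbor.
  common : ∀ u w → ∑[ l < v ] (a u l * a l w) ≡ ι ∣ N G u ∩ N G w ∣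
  common u w = begin
    ∑[ l < v ] (a u l * a l w)
      ≡⟨ sum-cong-≗ (λ l → trans (cong (a u l *_) (weights-sym G l w)) (sym (ind-∧ (adj G u l) (adj G w l)))) ⟩
    ∑[ l < v ] ind (adj G u l ∧ adj G w l)
      ≡⟨ ∑-ind (λ l → adj G u l ∧ adj G w l) ⟩
    ι ∣ tabulate (λ l → adj G u l ∧ adj G w l) ∣
      ≡⟨ cong (λ p → ι ∣ p ∣) (sym (tabulate-∩ (adj G u) (adj G w))) ⟩
    ι ∣ N G u ∩ N G w ∣ ∎
    where open ≡-Reasoning

  -- A² = (k − μ) I + (λ − μ) A + μ J
  square-entry : ∀ u w → ∑[ l < v ] (a u l * a l w) ≡
    ((ι k - ι mu) * unit u w + (ι lam - ι mu) * a u w) + ι mu * 𝟙 w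
  square-entry u w = trans (common u w) (entry (u Fin.≟ w))
    where
    open ≡-Reasoning
    entry : Dec (u ≡ w) → ι ∣ N G u ∩ N G w ∣ ≡
      ((ι k - ι mu) * unit u w + (ι lam - ι mu) * a u w) + ι mu * 𝟙 w
    entry (yes refl)
      rewrite Subset.∩-idem (N G u) | regular u | loopless G u | dec-true (u Fin.≟ u) refl =
      solve 3 (λ k l m → k := ((k :- m) :* con 1ℚ :+ (l :- m) :* con 0ℚ) :+ m :* con 1ℚ) refl
        (ι k) (ι lam) (ι mu)
    entry (no u≢w) with adj G u w in uw
    ... | true  rewrite adjacent u w uw | dec-false (u Fin.≟ w) u≢w =
      solve 3 (λ k l m → l := ((k :- m) :* con 0ℚ :+ (l :- m) :* con 1ℚ) :+ m :* con 1ℚ) refl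
        (ι k) (ι lam) (ι mu)
    ... | false rewrite nonadjacent u w u≢w uw | dec-false (u Fin.≟ w) u≢w =
      solve 3 (λ k l m → m := ((k :- m) :* con 0ℚ :+ (l :- m) :* con 0ℚ) :+ m :* con 1ℚ) refl
        (ι k) (ι lam) (ι mu)

  square-⊛ : ∀ x u → (a ⊛ (a ⊛ x)) u ≡
    ((ι k - ι mu) * x u + (ι lam - ι mu) * (a ⊛ x) u) + ι mu * sum x
  square-⊛ x u = begin
    (a ⊛ (a ⊛ x)) u
      ≡⟨ ∙-assoc (a u) a x ⟩
    (λ w → ∑[ l < v ] (a u l * a l w)) ∙ x
      ≡⟨ ∙-congˡ x (square-entry u) ⟩
    (λ w → ((ι k - ι mu) * unit u w + (ι lam - ι mu) * a u w) + ι mu * 𝟙 w) ∙ x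
      ≡⟨ ∙-distribʳ-+ x (λ w → (ι k - ι mu) * unit u w + (ι lam - ι mu) * a u w) (λ w → ι mu * 𝟙 w) ⟩
    (λ w → (ι k - ι mu) * unit u w + (ι lam - ι mu) * a u w) ∙ x + (λ w → ι mu * 𝟙 w) ∙ x
      ≡⟨ cong₂ _+_
           (trans (∙-distribʳ-+ x (λ w → (ι k - ι mu) * unit u w) (λ w → (ι lam - ι mu) * a u w))
             (cong₂ _+_
               (trans (∙-scaleˡ (ι k - ι mu) (unit u) x) (cong ((ι k - ι mu) *_) (unit-∙ u x)))
               (∙-scaleˡ (ι lam - ι mu) (a u) x)))
           (trans (∙-scaleˡ (ι mu) 𝟙 x) (cong (ι mu *_) (trans (∙-comm 𝟙 x) (∙-𝟙 x)))) ⟩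
    ((ι k - ι mu) * x u + (ι lam - ι mu) * (a ⊛ x) u) + ι mu * sum x ∎
    where open ≡-Reasoning

  -- The sum is an inner product with the all-ones vector, and moving A across it leaves A𝟙 = k𝟙 by
  -- regularity.
  sum-⊛ : ∀ x → sum (a ⊛ x) ≡ ι k * sum x
  sum-⊛ x = begin
    sum (a ⊛ x)              ≡⟨ sym (∙-𝟙 (a ⊛ x)) ⟩
    (a ⊛ x) ∙ 𝟙              ≡⟨ ∙-comm (a ⊛ x) 𝟙 ⟩
    𝟙 ∙ (a ⊛ x)              ≡⟨ selfAdjoint (weights-sym G) 𝟙 x ⟩
    (a ⊛ 𝟙) ∙ x              ≡⟨ ∙-congˡ x (λ u → trans (trans (∙-𝟙 (a u)) (row-sum u)) (sym (ℚ.*-identityʳ (ι k)))) ⟩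
    (λ _ → ι k * 1ℚ) ∙ x     ≡⟨ ∙-scaleˡ (ι k) 𝟙 x ⟩
    ι k * 𝟙 ∙ x              ≡⟨ cong (ι k *_) (trans (∙-comm 𝟙 x) (∙-𝟙 x)) ⟩
    ι k * sum x              ∎
    where open ≡-Reasoning

  shift : Vector ℚ v → Vector ℚ v
  shift x u = (a ⊛ x) u + m * x u

  -- e is the value of t² − (λ − μ)t − (k − μ) at t = −m, up to sign; if e = 0,
  -- then c is the other root.
  c e : ℚ
  c = ι lam - ι mu + m
  e = (ι k - ι mu) - m * c

  -- Polynomial division of the quadratic relation by A + mI: A(A + mI) = c(A + mI) + eI + μJ, with
  -- `e` as the remainder.
  ⊛-shift : ∀ x u → (a ⊛ shift x) u ≡ (c * shift x u + e * x u) + ι mu * sum x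
  ⊛-shift x u = begin
    (a ⊛ shift x) u
      ≡⟨ ∙-distribˡ-+ (a u) (a ⊛ x) (λ w → m * x w) ⟩
    (a ⊛ (a ⊛ x)) u + a u ∙ (λ w → m * x w)
      ≡⟨ cong₂ _+_ (square-⊛ x u) (∙-scaleʳ m (a u) x) ⟩
    ((ι k - ι mu) * x u + (ι lam - ι mu) * (a ⊛ x) u) + ι mu * sum x + m * (a ⊛ x) u
      ≡⟨ solve 7 (λ k l μ m y z s →
           ((k :- μ) :* y :+ (l :- μ) :* z) :+ μ :* s :+ m :* z :=
           ((l :- μ :+ m) :* (z :+ m :* y) :+ ((k :- μ) :- m :* (l :- μ :+ m)) :* y) :+ μ :* s)
           refl (ι k) (ι lam) (ι mu) m (x u) ((a ⊛ x) u) (sum x) ⟩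
    (c * shift x u + e * x u) + ι mu * sum x ∎
    where open ≡-Reasoning

  sum-shift : ∀ x → sum (shift x) ≡ (ι k + m) * sum x
  sum-shift x = begin
    sum (shift x)                     ≡⟨ ∑-distrib-+ (a ⊛ x) (λ u → m * x u) ⟩
    sum (a ⊛ x) + ∑[ u < v ] (m * x u) ≡⟨ cong₂ _+_ (sum-⊛ x) (sym (*-distribˡ-sum m x)) ⟩
    ι k * sum x + m * sum x           ≡⟨ sym (ℚ.*-distribʳ-+ (sum x) (ι k) m) ⟩
    (ι k + m) * sum x                 ∎
    where open ≡-Reasoning

-- Positive semidefiniteness of A + mI.

module Positivity {v} (G : Graph v) {k lam mu} (srg : IsSRG G k lam mu) (mu≤k : mu ℕ.≤ k)
  (m : ℚ) (0<m : 0ℚ ℚ.< m) (e≡0 : SRG.e G srg m ≡ 0ℚ) (u₀ : Fin v) where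

  open SRG G srg m

  private
    a : Fin v → Fin v → ℚ
    a = weights G

    K D : ℚ
    K = ι k + m
    D = c + m

  -- When `e` vanishes, `m * c` equals k - μ, which is nonnegative by `mu≤k`.
  0≤c : 0ℚ ℚ.≤ c
  0≤c = ℚ.*-cancelˡ-≤-pos m {{ℚ.positive 0<m}} (begin
    m * 0ℚ       ≡⟨ ℚ.*-zeroʳ m ⟩
    0ℚ           ≡⟨ sym (ℚ.+-inverseʳ (ι mu)) ⟩
    ι mu - ι mu  ≤⟨ ℚ.+-monoˡ-≤ (ℚ.- ι mu) (ι-mono-≤ mu≤k) ⟩
    ι k - ι mu   ≡⟨ solve 2 (λ x y → x := (x :- y) :+ y) refl (ι k - ι mu) (m * c) ⟩
    e + m * c    ≡⟨ cong (_+ m * c) e≡0 ⟩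
    0ℚ + m * c   ≡⟨ ℚ.+-identityˡ (m * c) ⟩
    m * c        ∎)
    where open ℚ.≤-Reasoning

  ⊛-shift₀ : ∀ x u → (a ⊛ shift x) u ≡ c * shift x u + ι mu * sum x * 𝟙 u
  ⊛-shift₀ x u = trans (⊛-shift x u) (trans
    (cong (λ e → (c * shift x u + e * x u) + ι mu * sum x) e≡0)
    (solve 3 (λ p q t → (p :+ con 0ℚ :* q) :+ t := p :+ t :* con 1ℚ) refl (c * shift x u) (x u) (ι mu * sum x)))

  -- The relation (A + mI)² = D(A + mI) + μJ as an identity of quadratic forms; self-adjointness
  -- moves one factor A + mI across the inner product.
  shift∙shift : ∀ y → shift y ∙ shift y ≡ D * y ∙ shift y + ι mu * (sum y * sum y)
  shift∙shift y = begin
    shift y ∙ r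
      ≡⟨ ∙-distribʳ-+ r (a ⊛ y) (λ u → m * y u) ⟩
    (a ⊛ y) ∙ r + (λ u → m * y u) ∙ r
      ≡⟨ cong₂ _+_ (sym (selfAdjoint (weights-sym G) y r)) (∙-scaleˡ m y r) ⟩
    y ∙ (a ⊛ r) + m * y ∙ r
      ≡⟨ cong (_+ m * y ∙ r) (trans (∙-congʳ y (⊛-shift₀ y))
           (trans (∙-distribˡ-+ y (λ u → c * r u) (λ u → ι mu * sum y * 𝟙 u))
             (cong₂ _+_ (∙-scaleʳ c y r)
               (trans (∙-scaleʳ (ι mu * sum y) y 𝟙) (cong (ι mu * sum y *_) (∙-𝟙 y)))))) ⟩
    c * y ∙ r + ι mu * sum y * sum y + m * y ∙ r
      ≡⟨ solve 5 (λ c m μ q s → c :* q :+ μ :* s :* s :+ m :* q := (c :+ m) :* q :+ μ :* (s :* s))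
           refl c m (ι mu) (y ∙ r) (sum y) ⟩
    D * y ∙ r + ι mu * (sum y * sum y) ∎
    where
    open ≡-Reasoning
    r = shift y

  -- ⊛-shift₀ evaluated at the all-ones vector.
  K*K : K * K ≡ D * K + ι mu * ι v
  K*K = begin
    K * K
      ≡⟨ solve 2 (λ k m → (k :+ m) :* (k :+ m) := (k :+ m) :* k :+ m :* (k :+ m)) refl (ι k) m ⟩
    K * ι k + m * K
      ≡⟨ cong (λ p → K * p + m * K) (sym (trans (∙-𝟙 (a u₀)) (row-sum u₀))) ⟩
    K * a u₀ ∙ 𝟙 + m * K
      ≡⟨ cong (_+ m * K) (sym (∙-scaleʳ K (a u₀) 𝟙)) ⟩
    a u₀ ∙ (λ u → K * 𝟙 u) + m * K
      ≡⟨ cong (_+ m * K) (∙-congʳ (a u₀) (λ u → sym (trans (shift-𝟙 u) (sym (ℚ.*-identityʳ K))))) ⟩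
    (a ⊛ shift 𝟙) u₀ + m * K
      ≡⟨ cong (_+ m * K) (⊛-shift₀ 𝟙 u₀) ⟩
    c * shift 𝟙 u₀ + ι mu * sum (𝟙 {v}) * 1ℚ + m * K
      ≡⟨ cong₂ (λ p q → c * p + ι mu * q * 1ℚ + m * K) (shift-𝟙 u₀) (sum-𝟙 {v}) ⟩
    c * K + ι mu * ι v * 1ℚ + m * K
      ≡⟨ solve 5 (λ c m K μ v → c :* K :+ μ :* v :* con 1ℚ :+ m :* K := (c :+ m) :* K :+ μ :* v)
           refl c m K (ι mu) (ι v) ⟩
    D * K + ι mu * ι v ∎
    where
    open ≡-Reasoning
    shift-𝟙 : ∀ u → shift 𝟙 u ≡ K
    shift-𝟙 u = cong₂ _+_ (trans (∙-𝟙 (a u)) (row-sum u)) (ℚ.*-identityʳ m)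

  -- With r = (A + mI)y and σ the sum of y, `shift∙shift` turns v D (y·r) into v r·r - v μ σ². By
  -- Cauchy-Schwarz, v r·r is at least the squared sum of r, which is K²σ². Since K² - μv = DK by
  -- `K*K`, what remains is DKσ², a nonnegative quantity.
  shift-nonNegative : ∀ y → 0ℚ ℚ.≤ y ∙ shift y
  shift-nonNegative y = ℚ.*-cancelˡ-≤-pos (ι v * D) {{ℚ.pos*pos⇒pos (ι v) {{0<v}} D {{0<D}}}} (begin
    ι v * D * 0ℚ
      ≡⟨ ℚ.*-zeroʳ (ι v * D) ⟩
    0ℚ
      ≤⟨ 0≤p*q (0≤p*q 0≤D (ℚ.+-mono-≤ (0≤ι k) (ℚ.<⇒≤ 0<m))) (0≤p*p σ) ⟩
    D * K * (σ * σ)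
      ≡⟨ solve 5 (λ D K σ μ v → D :* K :* (σ :* σ) :=
           (D :* K :+ μ :* v) :* (σ :* σ) :- v :* (μ :* (σ :* σ))) refl D K σ (ι mu) (ι v) ⟩
    (D * K + ι mu * ι v) * (σ * σ) - ι v * (ι mu * (σ * σ))
      ≡⟨ cong (λ p → p * (σ * σ) - ι v * (ι mu * (σ * σ))) (sym K*K) ⟩
    K * K * (σ * σ) - ι v * (ι mu * (σ * σ))
      ≡⟨ cong (_- ι v * (ι mu * (σ * σ)))
           (trans (solve 2 (λ K σ → K :* K :* (σ :* σ) := (K :* σ) :* (K :* σ)) refl K σ)
             (cong₂ _*_ (sym (sum-shift y)) (sym (sum-shift y)))) ⟩
    sum r * sum r - ι v * (ι mu * (σ * σ))
      ≤⟨ ℚ.+-monoˡ-≤ (ℚ.- (ι v * (ι mu * (σ * σ)))) (cauchySchwarz-sum r) ⟩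
    ι v * r ∙ r - ι v * (ι mu * (σ * σ))
      ≡⟨ cong (λ p → ι v * p - ι v * (ι mu * (σ * σ))) (shift∙shift y) ⟩
    ι v * (D * y ∙ r + ι mu * (σ * σ)) - ι v * (ι mu * (σ * σ))
      ≡⟨ solve 4 (λ v D q t → v :* (D :* q :+ t) :- v :* t := v :* D :* q) refl (ι v) D (y ∙ r) (ι mu * (σ * σ)) ⟩
    ι v * D * y ∙ r ∎)
    where
    open ℚ.≤-Reasoning
    r = shift y
    σ = sum y
    0<v : ℚ.Positive (ι v)
    0<v = ℚ.positive (ι-mono-< {0} {v} (ℕ.≤-<-trans ℕ.z≤n (Fin.toℕ<n u₀)))
    0<D : ℚ.Positive D
    0<D = ℚ.positive (ℚ.+-mono-≤-< 0≤c 0<m)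
    0≤D : 0ℚ ℚ.≤ D
    0≤D = ℚ.+-mono-≤ 0≤c (ℚ.<⇒≤ 0<m)

-- From a real eigenvector to an equation between the parameters

-- The relation `x ≈ y` unfolds to `Null` of the termwise difference, so rational identities that
-- hold exactly at each index replace arithmetic on reals.
Null : (ℕ → ℚ) → Set
Null s = ∀ ε → 0ℚ ℚ.< ε → ∃[ N ] (∀ i → N ℕ.≤ i → ℚ.∣ s i ∣ ℚ.≤ ε)

Null-resp : ∀ {s t} → (∀ i → s i ≡ t i) → Null s → Null t
Null-resp s≡t null ε 0<ε with null ε 0<ε
... | N , close = N , λ i N≤i → subst (λ p → ℚ.∣ p ∣ ℚ.≤ ε) (s≡t i) (close i N≤i)

Null-0 : Null (λ _ → 0ℚ)
Null-0 ε 0<ε = 0 , λ _ _ → ℚ.<⇒≤ 0<ε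

Null-+ : ∀ {s t} → Null s → Null t → Null (λ i → s i + t i)
Null-+ {s} {t} null-s null-t ε 0<ε
  with null-s (ε * ℚ.½) 0<ε/2 | null-t (ε * ℚ.½) 0<ε/2
  where
  0<ε/2 : 0ℚ ℚ.< ε * ℚ.½
  0<ε/2 = ℚ.positive⁻¹ (ε * ℚ.½) {{ℚ.pos*pos⇒pos ε {{ℚ.positive 0<ε}} ℚ.½}}
... | M , close-s | N , close-t = M ℕ.⊔ N , λ i M⊔N≤i → begin
  ℚ.∣ s i + t i ∣         ≤⟨ ℚ.∣p+q∣≤∣p∣+∣q∣ (s i) (t i) ⟩
  ℚ.∣ s i ∣ + ℚ.∣ t i ∣   ≤⟨ ℚ.+-mono-≤ (close-s i (ℕ.m⊔n≤o⇒m≤o M N M⊔N≤i)) (close-t i (ℕ.m⊔n≤o⇒n≤o M N M⊔N≤i)) ⟩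
  ε * ℚ.½ + ε * ℚ.½       ≡⟨ solve 1 (λ ε → ε :* con ℚ.½ :+ ε :* con ℚ.½ := ε) refl ε ⟩
  ε                       ∎
  where open ℚ.≤-Reasoning

Null-scale : ∀ c {s} → Null s → Null (λ i → c * s i)
Null-scale c {s} null ε 0<ε = M , λ i M≤i → begin
    ℚ.∣ c * s i ∣       ≡⟨ ℚ.∣p*q∣≡∣p∣*∣q∣ c (s i) ⟩
    ℚ.∣ c ∣ * ℚ.∣ s i ∣ ≤⟨ ℚ.*-monoˡ-≤-nonNeg ℚ.∣ c ∣ {{ℚ.nonNegative (ℚ.0≤∣p∣ c)}} (close i M≤i) ⟩
    ℚ.∣ c ∣ * δ         ≤⟨ ℚ.*-monoʳ-≤-nonNeg δ {{ℚ.pos⇒nonNeg δ}}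
                             (subst (ℚ._≤ B) (ℚ.+-identityˡ ℚ.∣ c ∣) (ℚ.+-monoˡ-≤ ℚ.∣ c ∣ (ℚ.<⇒≤ (ℚ.positive⁻¹ 1ℚ)))) ⟩
    B * δ               ≡⟨ solve 3 (λ B ε B⁻¹ → B :* (ε :* B⁻¹) := ε :* (B :* B⁻¹)) refl B ε (ℚ.1/ B) ⟩
    ε * (B * ℚ.1/ B)    ≡⟨ trans (cong (ε *_) (ℚ.*-inverseʳ B)) (ℚ.*-identityʳ ε) ⟩
    ε                   ∎
  where
  open ℚ.≤-Reasoning
  -- The added one keeps the divisor positive when `c` is zero.
  B = 1ℚ + ℚ.∣ c ∣
  instance
    posε : ℚ.Positive ε
    posε = ℚ.positive 0<ε
    posB : ℚ.Positive B
    posB = ℚ.positive (ℚ.+-mono-<-≤ (ℚ.positive⁻¹ 1ℚ) (ℚ.0≤∣p∣ c))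
    nzB : ℚ.NonZero B
    nzB = ℚ.pos⇒nonZero B
    pos1/B : ℚ.Positive (ℚ.1/ B)
    pos1/B = ℚ.1/pos⇒pos B
  δ = ε * ℚ.1/ B
  instance
    posδ : ℚ.Positive δ
    posδ = ℚ.pos*pos⇒pos ε (ℚ.1/ B)
  M = proj₁ (null δ (ℚ.positive⁻¹ δ))
  close = proj₂ (null δ (ℚ.positive⁻¹ δ))

Null-sum : ∀ (s : Fin n → ℕ → ℚ) → (∀ j → Null (s j)) → Null (λ i → ∑[ j < n ] s j i)
Null-sum {zero}  s null = Null-0
Null-sum {suc n} s null = Null-+ (null zero) (Null-sum (s ∘ suc) (null ∘ suc))

Null-cancel : ∀ c {s} → c ≢ 0ℚ → Null (λ i → c * s i) → Null s
Null-cancel c {s} c≢0 null = Null-resp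
  (λ i → trans (sym (ℚ.*-assoc (ℚ.1/ c) c (s i)))
    (trans (cong (_* s i) (ℚ.*-inverseˡ c)) (ℚ.*-identityˡ (s i))))
  (Null-scale (ℚ.1/ c) null)
  where
  instance
    nz : ℚ.NonZero c
    nz = ℚ.≢-nonZero c≢0

-- The eigenvalue enters as a quotient with denominator 1, cardinalities enter through `ι`. The two
-- are compared as unnormalised fractions, where addition involves no reduction to lowest terms.
toℚᵘ-ι : ∀ n → ℚ.toℚᵘ (ι n) ℚᵘ.≃ ℚᵘ.mkℚᵘ (ℤ.+ n) 0
toℚᵘ-ι zero    = ℚᵘ.≃-refl
toℚᵘ-ι (suc n) = ℚᵘ.≃-trans (ℚ.toℚᵘ-homo-+ 1ℚ (ι n))
  (ℚᵘ.≃-trans (ℚᵘ.+-congʳ (ℚ.toℚᵘ 1ℚ) (toℚᵘ-ι n))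
    (ℚᵘ.*≡* (cong (λ z → (ℤ.+ 1 ℤ.+ z) ℤ.* ℤ.+ 1) (ℤ.*-identityʳ (ℤ.+ n)))))

n/1≡ι : ∀ n → (ℤ.+ n) ℚ./ 1 ≡ ι n
n/1≡ι n = ℚ.toℚᵘ-injective
  (ℚᵘ.≃-trans (ℚ.toℚᵘ-fromℚᵘ (ℚᵘ.mkℚᵘ (ℤ.+ n) 0)) (ℚᵘ.≃-sym (toℚᵘ-ι n)))

-n/1≡-ι : ∀ n → (ℤ.- (ℤ.+ n)) ℚ./ 1 ≡ ℚ.- ι n
-n/1≡-ι zero    = refl
-n/1≡-ι (suc n) = cong ℚ.-_ (n/1≡ι (suc n))

seq-sum : ∀ (x : Vector ℝ n) i →
  seq (RawMonoid.sum +ʳ-rawMonoid x) i ≡ ∑[ j < n ] seq (x j) i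
seq-sum {zero}  x i = refl
seq-sum {suc n} x i = cong (seq (x zero) i +_) (seq-sum (x ∘ suc) i)

seq-adjacencyMatrix : ∀ (G : Graph n) u w i → seq (adjacencyMatrix G u w) i ≡ weights G u w
seq-adjacencyMatrix G u w i with adj G u w
... | true  = refl
... | false = refl

module _ {v} (G : Graph v) {k lam mu} (srg : IsSRG G k lam mu) (m : ℕ) (0<m : 0 ℕ.< m) where

  open SRG G srg (ι m)

  -- (k + m) e x is a fixed linear combination of the entries of (A + mI) x,
  -- which are null sequences; so e ≠ 0 would make the eigenvector x vanish.
  eigenvalue-equation : IsEigenvalue (adjacencyMatrix G) (fromℤ (ℤ.- (ℤ.+ m))) → e ≡ 0ℚ
  -- The eigenvector is only known not to vanish identically, with no nonzero entry singled out.
  -- Equality in ℚ is decidable, so refuting `e ≢ 0ℚ` suffices.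
  eigenvalue-equation (x , x≉0 , Ax≈θx) = decidable-stable (e ℚ.≟ 0ℚ) λ e≢0 →
    x≉0 λ u → Null-resp (λ i → sym (ℚ.+-identityʳ (seq (x u) i)))
      (Null-cancel e e≢0 (Null-cancel K K≢0 (vanishing u)))
    where
    X : ℕ → Vector ℚ v
    X i u = seq (x u) i

    K : ℚ
    K = ι k + ι m

    K≢0 : K ≢ 0ℚ
    K≢0 K≡0 = ℚ.<-irrefl (sym K≡0) (ℚ.+-mono-≤-< (0≤ι k) (ι-mono-< 0<m))

    residual : ∀ u → Null (λ i → shift (X i) u)
    residual u = Null-resp eq (Ax≈θx u)
      where
      eq : ∀ i → seq ((adjacencyMatrix G · x) u) i - (ℤ.- (ℤ.+ m)) ℚ./ 1 * X i u ≡ shift (X i) u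
      eq i = trans
        (cong₂ (λ p q → p - q * X i u)
          (trans (seq-sum (λ w → adjacencyMatrix G u w *ʳ x w) i)
            (∙-congˡ (X i) (λ w → seq-adjacencyMatrix G u w i)))
          (-n/1≡-ι m))
        (solve 3 (λ p m x → p :- (:- m) :* x := p :+ m :* x) refl
          ((weights G ⊛ X i) u) (ι m) (X i u))

    vanishing : ∀ u → Null (λ i → K * (e * X i u))
    vanishing u = Null-resp eq
      -- With r = (A + mI)x the combination is K(Ar - cr) - μ (sum of r). The factor `K` makes the
      -- two μ terms cancel, because r sums to `K` times the sum of x.
      (Null-+ (Null-scale K (Null-+ (Null-sum _ (λ w → Null-scale (weights G u w) (residual w)))
                                    (Null-scale (ℚ.- c) (residual u))))
              (Null-scale (ℚ.- ι mu) (Null-sum _ residual)))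
      where
      eq : ∀ i → K * ((weights G ⊛ shift (X i)) u + (ℚ.- c) * shift (X i) u)
                 + (ℚ.- ι mu) * sum (shift (X i)) ≡ K * (e * X i u)
      eq i = trans
        (cong₂ (λ p q → K * (p + (ℚ.- c) * shift (X i) u) + (ℚ.- ι mu) * q)
          (⊛-shift (X i) u) (sum-shift (X i)))
        (solve 6 (λ K c r ex μ s → K :* (((c :* r :+ ex) :+ μ :* s) :+ (:- c) :* r) :+ (:- μ) :* (K :* s)
          := K :* ex) refl K c (shift (X i) u) (e * X i u) (ι mu) (sum (X i)))

-- In dimension zero every vector vanishes vacuously and cannot be an eigenvector. The vertex
-- obtained makes `ι v` positive and the empty set shattered.
eigenvector-vertex : ∀ {M : Matrix n} {θ} → IsEigenvalue M θ → Fin n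
eigenvector-vertex {zero}  (x , x≉0 , _) = contradiction (λ ()) x≉0
eigenvector-vertex {suc n} _             = zero

-- Shattered sets

-- The first argument says whether the vertex lies in the support, the second whether its sign is
-- negative.
sgn : Bool → Bool → ℚ
sgn false _     = 0ℚ
sgn true  true  = ℚ.- 1ℚ
sgn true  false = 1ℚ

signed : (Fin n → Bool) → (Fin n → Bool) → Vector ℚ n
signed s b i = sgn (s i) (b i)

-- The signs are chosen greedily, each opposite to the sum of the weighted
-- signs chosen before it.
signs : ∀ (a : Fin n → Fin n → ℚ) → (∀ i j → a i j ≡ a j i) → (∀ i → a i i ≡ 0ℚ) →
        ∀ s → ∃[ b ] (signed s b ∙ (a ⊛ signed s b) ℚ.≤ 0ℚ)
signs {zero}  a a-sym a-diag s = (λ ()) , ℚ.≤-refl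
signs {suc n} a a-sym a-diag s
  with signs (λ i j → a (suc i) (suc j)) (λ i j → a-sym (suc i) (suc j)) (a-diag ∘ suc) (s ∘ suc)
... | b , form≤0 = proj₁ first Vector.∷ b , (begin
    x₀ * (a zero zero * x₀ + t) + (λ i → x i) ∙ (λ i → a (suc i) zero * x₀ + (a′ ⊛ x) i)
      ≡⟨ cong₂ (λ p q → x₀ * (p * x₀ + t) + q) (a-diag zero) cross ⟩
    x₀ * (0ℚ * x₀ + t) + (x₀ * t + x ∙ (a′ ⊛ x))
      ≡⟨ solve 3 (λ x t q → x :* (con 0ℚ :* x :+ t) :+ (x :* t :+ q) := x :* t :+ (x :* t :+ q)) refl x₀ t (x ∙ (a′ ⊛ x)) ⟩
    x₀ * t + (x₀ * t + x ∙ (a′ ⊛ x))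
      -- As the diagonal is zero, the new vertex changes the form by exactly 2 `x₀` `t`, and
      -- `choose` makes `x₀ * t` nonpositive.
      ≤⟨ ℚ.+-mono-≤ (proj₂ first) (ℚ.+-mono-≤ (proj₂ first) form≤0) ⟩
    0ℚ ∎)
  where
  open ℚ.≤-Reasoning
  x : Vector ℚ n
  x = signed (s ∘ suc) b
  a′ : Fin n → Fin n → ℚ
  a′ i j = a (suc i) (suc j)
  t : ℚ
  t = (a zero ∘ suc) ∙ x
  choose : ∀ p → ∃[ β ] (sgn p β * t ℚ.≤ 0ℚ)
  choose false = false , ℚ.≤-reflexive (ℚ.*-zeroˡ t)
  choose true with ℚ.≤-total 0ℚ t
  ... | inj₁ 0≤t = true , subst (ℚ._≤ 0ℚ) (solve 1 (λ t → :- t := con (ℚ.- 1ℚ) :* t) refl t) (ℚ.neg-antimono-≤ 0≤t)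
  ... | inj₂ t≤0 = false , subst (ℚ._≤ 0ℚ) (sym (ℚ.*-identityˡ t)) t≤0
  first = choose (s zero)
  x₀ = sgn (s zero) (proj₁ first)
  cross : x ∙ (λ i → a (suc i) zero * x₀ + (a′ ⊛ x) i) ≡ x₀ * t + x ∙ (a′ ⊛ x)
  cross = trans (∙-distribˡ-+ x (λ i → a (suc i) zero * x₀) (a′ ⊛ x))
    (cong (_+ x ∙ (a′ ⊛ x)) (trans
      (∙-congʳ x (λ i → trans (cong (_* x₀) (a-sym (suc i) zero)) (ℚ.*-comm _ x₀)))
      (trans (∙-scaleʳ x₀ x (a zero ∘ suc)) (cong (x₀ *_) (∙-comm x (a zero ∘ suc))))))

signed∙signed : ∀ (s b : Fin n → Bool) → signed s b ∙ signed s b ≡ ι ∣ tabulate s ∣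
signed∙signed s b = trans (sum-cong-≗ (λ i → square (s i) (b i))) (∑-ind s)
  where
  square : ∀ p q → sgn p q * sgn p q ≡ ind p
  square false q     = refl
  square true  true  = refl
  square true  false = refl

signed-not : ∀ (s b : Fin n → Bool) i → signed s (not ∘ b) i ≡ (ℚ.- 1ℚ) * signed s b i
signed-not s b i = flip (s i) (b i)
  where
  flip : ∀ p q → sgn p (not q) ≡ (ℚ.- 1ℚ) * sgn p q
  flip false q     = refl
  flip true  true  = refl
  flip true  false = refl

-- A quadratic form is even, so one greedy choice of signs serves for both x and -x.
form-not : ∀ (a : Fin n → Fin n → ℚ) s b →
  signed s (not ∘ b) ∙ (a ⊛ signed s (not ∘ b)) ≡ signed s b ∙ (a ⊛ signed s b)
form-not a s b = begin
  x̄ ∙ (a ⊛ x̄)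
    ≡⟨ ∙-congˡ (a ⊛ x̄) (signed-not s b) ⟩
  (λ i → (ℚ.- 1ℚ) * x i) ∙ (a ⊛ x̄)
    ≡⟨ ∙-congʳ (λ i → (ℚ.- 1ℚ) * x i) (λ i → trans (∙-congʳ (a i) (signed-not s b)) (∙-scaleʳ (ℚ.- 1ℚ) (a i) x)) ⟩
  (λ i → (ℚ.- 1ℚ) * x i) ∙ (λ i → (ℚ.- 1ℚ) * (a ⊛ x) i)
    ≡⟨ trans (∙-scaleˡ (ℚ.- 1ℚ) x _) (cong ((ℚ.- 1ℚ) *_) (∙-scaleʳ (ℚ.- 1ℚ) x (a ⊛ x))) ⟩
  (ℚ.- 1ℚ) * ((ℚ.- 1ℚ) * x ∙ (a ⊛ x))
    ≡⟨ solve 1 (λ q → con (ℚ.- 1ℚ) :* (con (ℚ.- 1ℚ) :* q) := q) refl (x ∙ (a ⊛ x)) ⟩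
  x ∙ (a ⊛ x) ∎
  where
  open ≡-Reasoning
  x x̄ : Vector ℚ _
  x = signed s b
  x̄ = signed s (not ∘ b)

∣∧∣+∣∧not∣ : ∀ (s b : Fin n → Bool) →
  ι ∣ tabulate (λ i → s i ∧ b i) ∣ + ι ∣ tabulate (λ i → s i ∧ not (b i)) ∣ ≡ ι ∣ tabulate s ∣
∣∧∣+∣∧not∣ s b = begin
  ι ∣ tabulate (λ i → s i ∧ b i) ∣ + ι ∣ tabulate (λ i → s i ∧ not (b i)) ∣
    ≡⟨ sym (cong₂ _+_ (∑-ind (λ i → s i ∧ b i)) (∑-ind (λ i → s i ∧ not (b i)))) ⟩
  sum (λ i → ind (s i ∧ b i)) + sum (λ i → ind (s i ∧ not (b i)))
    ≡⟨ sym (∑-distrib-+ (λ i → ind (s i ∧ b i)) (λ i → ind (s i ∧ not (b i)))) ⟩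
  sum (λ i → ind (s i ∧ b i) + ind (s i ∧ not (b i)))
    ≡⟨ sum-cong-≗ (λ i → split (s i) (b i)) ⟩
  sum (ind ∘ s)
    ≡⟨ ∑-ind s ⟩
  ι ∣ tabulate s ∣ ∎
  where
  open ≡-Reasoning
  split : ∀ p q → ind (p ∧ q) + ind (p ∧ not q) ≡ ind p
  split false q     = refl
  split true  true  = refl
  split true  false = refl

module Shattering {v} (G : Graph v) (m : ℕ)
  (A+m≥0 : ∀ y → 0ℚ ℚ.≤ y ∙ (λ u → (weights G ⊛ y) u + ι m * y u))
  (S : Subset v) (shattered : Shattered G S) where

  private
    a : Fin v → Fin v → ℚ
    a = weights G

    s : Fin v → Bool
    s = lookup S

    -- `bound` is m times an upper estimate of the squared norm of x + αe_u. Any α above m would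
    -- leave a positive coefficient α - m on |S| at the end; α = m + 1 makes it 1.
    d α bound : ℚ
    d     = ι ∣ S ∣
    α     = ι (suc m)
    bound = ι m * (d + (α + α) + α * α)

  negative : (Fin v → Bool) → Subset v
  negative b = tabulate (λ i → s i ∧ b i)

  negative⊆S : ∀ b → negative b ⊆ S
  negative⊆S b {i} i∈ = Vec.lookup⇒[]= i S (trueˡ (trans (sym (Vec.lookup∘tabulate _ i)) (Vec.[]=⇒lookup i∈)))
    where
    trueˡ : ∀ {p q} → p ∧ q ≡ true → p ≡ true
    trueˡ {true} _ = refl

  test-vector : ∀ b → signed s b ∙ (a ⊛ signed s b) ℚ.≤ 0ℚ → (α + α) * ι ∣ negative b ∣ ℚ.≤ bound
  test-vector b form≤0 with shattered (negative b) (negative⊆S b)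
  ... | u , Nu∩S≡A = 0≤q-p⇒p≤q (begin
      0ℚ
        ≤⟨ A+m≥0 y ⟩
      y ∙ (λ w → (a ⊛ y) w + ι m * y w)
        ≡⟨ trans (∙-distribˡ-+ y (a ⊛ y) (λ w → ι m * y w)) (cong (y ∙ (a ⊛ y) +_) (∙-scaleʳ (ι m) y y)) ⟩
      y ∙ (a ⊛ y) + ι m * y ∙ y
        ≡⟨ cong₂ (λ p q → p + ι m * q) y∙Ay y∙y ⟩
      Q + (α + α) * (ℚ.- A#) + ι m * (d + (α + α) * x u + α * α)
        -- The vertex `u` may itself lie in S, so the norm contains a cross term in `x u`; it is
        -- estimated by `x u` ≤ 1.
        ≤⟨ ℚ.+-mono-≤ (ℚ.+-monoˡ-≤ ((α + α) * (ℚ.- A#)) form≤0)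
             (ℚ.*-monoˡ-≤-nonNeg (ι m) {{ℚ.nonNegative (0≤ι m)}}
               (ℚ.+-monoˡ-≤ (α * α) (ℚ.+-monoʳ-≤ d
                 (ℚ.*-monoˡ-≤-nonNeg (α + α) {{ℚ.nonNegative (ℚ.+-mono-≤ (0≤ι (suc m)) (0≤ι (suc m)))}} (sgn≤1 (s u) (b u)))))) ⟩
      0ℚ + (α + α) * (ℚ.- A#) + ι m * (d + (α + α) * 1ℚ + α * α)
        ≡⟨ solve 4 (λ α A m d → con 0ℚ :+ (α :+ α) :* (:- A) :+ m :* (d :+ (α :+ α) :* con 1ℚ :+ α :* α)
             := m :* (d :+ (α :+ α) :+ α :* α) :- (α :+ α) :* A) refl α A# (ι m) d ⟩
      bound - (α + α) * A# ∎)
    where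
    open ℚ.≤-Reasoning
    A# = ι ∣ negative b ∣
    x y : Vector ℚ v
    x = signed s b
    y i = x i + α * unit u i
    Q = x ∙ (a ⊛ x)

    sgn≤1 : ∀ p q → sgn p q ℚ.≤ 1ℚ
    sgn≤1 false q     = ℚ.<⇒≤ (ℚ.positive⁻¹ 1ℚ)
    sgn≤1 true  true  = ℚ.<⇒≤ (ℚ.neg<pos (ℚ.- 1ℚ) 1ℚ)
    sgn≤1 true  false = ℚ.≤-refl

    membership : ∀ i → adj G u i ∧ s i ≡ s i ∧ b i
    membership i = trans
      (sym (trans (Vec.lookup-zipWith _∧_ i (N G u) S) (cong (_∧ s i) (Vec.lookup∘tabulate (adj G u) i))))
      (trans (cong (λ p → lookup p i) Nu∩S≡A) (Vec.lookup∘tabulate _ i))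

    -- Within S, adjacency to `u` coincides with having sign -1, so only negative entries contribute
    -- to (Ax)_u.
    term : ∀ p q r → p ∧ q ≡ q ∧ r → ind p * sgn q r ≡ (ℚ.- 1ℚ) * ind (q ∧ r)
    term p     false r     _ = ℚ.*-zeroʳ (ind p)
    term true  true  true  _ = refl
    term false true  false _ = refl

    Ax-u : (a ⊛ x) u ≡ ℚ.- A#
    Ax-u = trans (sum-cong-≗ (λ i → term (adj G u i) (s i) (b i) (membership i)))
      (trans (sym (*-distribˡ-sum (ℚ.- 1ℚ) (λ i → ind (s i ∧ b i))))
        (trans (cong ((ℚ.- 1ℚ) *_) (∑-ind (λ i → s i ∧ b i)))
          (solve 1 (λ A → con (ℚ.- 1ℚ) :* A := :- A) refl A#)))

    y∙Ay : y ∙ (a ⊛ y) ≡ Q + (α + α) * (ℚ.- A#)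
    y∙Ay = trans (form-+-unit a (weights-sym G) x α u)
      (trans (cong₂ (λ p q → Q + (α + α) * p + α * α * ind q) Ax-u (loopless G u))
        (trans (cong (Q + (α + α) * (ℚ.- A#) +_) (ℚ.*-zeroʳ (α * α))) (ℚ.+-identityʳ _)))

    y∙y : y ∙ y ≡ d + (α + α) * x u + α * α
    y∙y = trans (∙-congʳ y (λ i → sym (unit-∙ i y)))
      (trans (form-+-unit unit unit-sym x α u)
        (cong₂ _+_
          (cong₂ (λ p q → p + (α + α) * q)
            (trans (∙-congʳ x (λ i → unit-∙ i x))
              (trans (signed∙signed s b) (cong (λ p → ι ∣ p ∣) (Vec.tabulate∘lookup S))))
            (unit-∙ u x))
          (trans (cong (λ p → α * α * ind p) (dec-true (u Fin.≟ u) refl)) (ℚ.*-identityʳ (α * α)))))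

  -- The negative parts of x and -x partition S, so adding the two instances of `test-vector` gives
  -- 2α|S| ≤ 2 `bound`.
  ∣S∣≤ : ∣ S ∣ ℕ.≤ m ℕ.* (suc m ℕ.* (3 ℕ.+ m))
  ∣S∣≤ with signs a (weights-sym G) (λ u → cong ind (loopless G u)) s
  ... | b , form≤0 = ι-cancel-≤ (0≤q-p⇒p≤q (ℚ.*-cancelˡ-≤-pos (1ℚ + 1ℚ) (begin
      (1ℚ + 1ℚ) * 0ℚ
        ≡⟨ sym (ℚ.+-inverseʳ ((α + α) * d)) ⟩
      (α + α) * d - (α + α) * d
        ≤⟨ ℚ.+-monoˡ-≤ (ℚ.- ((α + α) * d)) twice ⟩
      bound + bound - (α + α) * d
        -- Here α - m = 1 and 2α + α² = α(m + 3), so half the difference is m(m + 1)(m + 3) - |S|.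
        ≡⟨ solve 2 (λ m d → let α = con 1ℚ :+ m ; B = m :* (d :+ (α :+ α) :+ α :* α) in
             B :+ B :- (α :+ α) :* d :=
             (con 1ℚ :+ con 1ℚ) :* (m :* (α :* (con 1ℚ :+ (con 1ℚ :+ (con 1ℚ :+ m)))) :- d)) refl (ι m) d ⟩
      (1ℚ + 1ℚ) * (ι m * (α * ι (3 ℕ.+ m)) - d)
        ≡⟨ cong (λ p → (1ℚ + 1ℚ) * (p - d))
             (sym (trans (×1-homo-* m (suc m ℕ.* (3 ℕ.+ m))) (cong (ι m *_) (×1-homo-* (suc m) (3 ℕ.+ m))))) ⟩
      (1ℚ + 1ℚ) * (ι (m ℕ.* (suc m ℕ.* (3 ℕ.+ m))) - d) ∎)))
    where
    open ℚ.≤-Reasoning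
    twice : (α + α) * d ℚ.≤ bound + bound
    twice = begin
      (α + α) * d
        ≡⟨ cong ((α + α) *_) (sym (trans (∣∧∣+∣∧not∣ s b) (cong (λ p → ι ∣ p ∣) (Vec.tabulate∘lookup S)))) ⟩
      (α + α) * (ι ∣ negative b ∣ + ι ∣ negative (not ∘ b) ∣)
        ≡⟨ ℚ.*-distribˡ-+ (α + α) _ _ ⟩
      (α + α) * ι ∣ negative b ∣ + (α + α) * ι ∣ negative (not ∘ b) ∣
        ≤⟨ ℚ.+-mono-≤ (test-vector b form≤0)
             (test-vector (not ∘ b) (ℚ.≤-trans (ℚ.≤-reflexive (form-not a s b)) form≤0)) ⟩
      bound + bound ∎

-- Existence of the VC-dimension of a finite graph.

-- Shattering is recast as the absence of a subset of S that is not a trace, which a finite search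
-- decides. Decidability lets an upper bound on shattered sets yield an exact maximum.
shattered? : ∀ (G : Graph n) → Decidable (Shattered G)
shattered? G S = map′
  (λ none A A⊆S → decidable-stable (trace? A) (λ ¬trace → none (A , (λ {x} → A⊆S {x}) , ¬trace)))
  (λ shattered (A , A⊆S , ¬trace) → ¬trace (shattered A A⊆S))
  (¬? (Subset.anySubset? (λ A → (A Subset.⊆? S) ×-dec ¬? (trace? A))))
  where
  trace? : ∀ A → Dec (∃[ u ] N G u ∩ S ≡ A)
  trace? A = Fin.any? (λ u → Vec.≡-dec Bool._≟_ (N G u ∩ S) A)

⊥-shattered : ∀ (G : Graph n) → Fin n → Shattered G ⊥
⊥-shattered G u A A⊆⊥ = u , trans (Subset.∩-zeroʳ (N G u)) (Subset.⊆-antisym (Subset.⊆-min A) A⊆⊥)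

-- A downward search from the bound: each failing value lowers the bound by one, and `P 0` ends the
-- search.
maximum : ∀ {P : ℕ → Set} → Decidable P → P 0 → ∀ C → (∀ d → P d → d ℕ.≤ C) →
          ∃[ d ] (P d × (∀ e → P e → e ℕ.≤ d))
maximum P? P0 zero    P≤C = 0 , P0 , P≤C
maximum P? P0 (suc C) P≤C with P? (suc C)
... | yes PC = suc C , PC , P≤C
... | no ¬PC = maximum P? P0 C λ d Pd →
  ℕ.s≤s⁻¹ (ℕ.≤∧≢⇒< (P≤C d Pd) λ { refl → ¬PC Pd })

vcDimension : ∀ (G : Graph n) → Fin n → ∀ C → (∀ S → Shattered G S → ∣ S ∣ ℕ.≤ C) →
              ∃[ d ] (IsVCDimension G d × d ℕ.≤ C)
vcDimension {n} G u C bounded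
  with maximum
    (λ d → Subset.anySubset? (λ S → shattered? G S ×-dec (∣ S ∣ ℕ.≟ d)))
    (⊥ , ⊥-shattered G u , Subset.∣⊥∣≡0 n)
    C
    (λ { _ (S , shattered , refl) → bounded S shattered })
... | _ , (S , shattered , refl) , maximal =
  ∣ S ∣ , ((S , shattered , refl) , λ T shatteredT → maximal ∣ T ∣ (T , shatteredT , refl)) , bounded S shattered

-- The uniform bound m(m + 1)(m + 3) on the VC-dimension.

open import Data.Integer using (+_; -_)

corollary40 : ∀ (m : ℕ) → 2 ≤ m →
    ∃[ C ] (∀ (v : ℕ) (G : Graph v) →
    StronglyRegular G →
    IsSmallestEigenvalue (adjacencyMatrix G) (fromℤ (- (+ m))) →
    ∃[ d ] (IsVCDimension G d × d ≤ C))
corollary40 m 2≤m = m ℕ.* (suc m ℕ.* (3 ℕ.+ m)) , λ v G stronglyRegular (eigenvalue , _) →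
  let k , lam , mu , srg , mu≤k = μ≤k-parameters G stronglyRegular
      0<m = ℕ.<-trans (ℕ.s≤s ℕ.z≤n) 2≤m
      u = eigenvector-vertex {M = adjacencyMatrix G} {θ = fromℤ (- (+ m))} eigenvalue
      A+m≥0 = Positivity.shift-nonNegative G srg mu≤k (ι m) (ι-mono-< 0<m)
                (eigenvalue-equation G srg m 0<m eigenvalue) u
  in vcDimension G u (m ℕ.* (suc m ℕ.* (3 ℕ.+ m))) (Shattering.∣S∣≤ G m A+m≥0)
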